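{- Let $H = C_5 + C_5 + C_5 + C_5 + C_5 + C_5$ be the Zykov sum of six disjoint copies of the $5$-cycle $C_5$. Then $H \to_e (3,3,3)$, i.e. for every coloring of the edges of $H$ in three colors there is a monochromatic triangle.
   Context: All graphs are finite, undirected, without loops or multiple edges. The Zykov sum $G_1+G_2$ of two vertex-disjoint graphs is the graph obtained from $G_1$ and $G_2$ by joining every vertex of $G_1$ to every vertex of $G_2$ (this operation is associative). For positive integers $a_1,\dots,a_r$, $G \to_e (a_1,\dots,a_r)$ means that for every coloring of $E(G)$ in $r$ colors there is some $i\in\{1,\dots,r\}$ and an $a_i$-clique all of whose edges have color $i$. -}

module Defs where

open import Data.Fin using (Fin; toℕ; _≟_)
open import Data.Fin.Properties using (+↔⊎; all?)
open import Data.Nat as ℕ using (ℕ; suc)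
open import Data.Nat.DivMod using (_mod_)
open import Data.Product using (Σ-syntax; ∃-syntax)
open import Data.Sum using (_⊎_; inj₁; inj₂; swap)
open import Data.Sum.Function.Propositional using (_⊎-↔_)
open import Data.Unit using (⊤; tt)
open import Data.Vec using (Vec; lookup)
open import Function using (_↔_)
open import Function.Properties.Inverse using (↔-refl; ↔-sym; ↔-trans)
open import Level using (0ℓ)
open import Relation.Binary.Core using (Rel)
open import Relation.Binary.Definitions using (Decidable; Irreflexive; Symmetric)
open import Relation.Binary.PropositionalEquality using (_≡_; _≢_; refl)
open import Relation.Nullary using (¬_; yes)
open import Relation.Nullary.Decidable using (_⊎-dec_; ¬?; from-yes)

record Graph : Set₁ where
  field
    Vertex : Set
    order  : ℕ
    finite : Vertex ↔ Fin order
    Adj    : Rel Vertex 0ℓ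
    adj?   : Decidable Adj
    sym    : Symmetric Adj
    irrefl : Irreflexive _≡_ Adj

open Graph

infixl 6 _+ᶻ_

-- The Zykov sum. Disjointness of the summands is built into the vertex set ⊎.
_+ᶻ_ : Graph → Graph → Graph
G₁ +ᶻ G₂ = record
  { Vertex = V
  ; order  = order G₁ ℕ.+ order G₂
  ; finite = ↔-trans (finite G₁ ⊎-↔ finite G₂) (↔-sym +↔⊎)
  ; Adj    = A
  ; adj?   = A?
  ; sym    = λ {u} {v} → A-sym u v
  ; irrefl = λ { {u} refl → A-irrefl u }
  }
  where
  V : Set
  V = Vertex G₁ ⊎ Vertex G₂

  A : Rel V 0ℓ
  A (inj₁ u) (inj₁ v) = Adj G₁ u v
  A (inj₁ _) (inj₂ _) = ⊤
  A (inj₂ _) (inj₁ _) = ⊤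
  A (inj₂ u) (inj₂ v) = Adj G₂ u v

  A? : Decidable A
  A? (inj₁ u) (inj₁ v) = adj? G₁ u v
  A? (inj₁ _) (inj₂ _) = yes tt
  A? (inj₂ _) (inj₁ _) = yes tt
  A? (inj₂ u) (inj₂ v) = adj? G₂ u v

  A-sym : ∀ u v → A u v → A v u
  A-sym (inj₁ _) (inj₁ _) = sym G₁
  A-sym (inj₁ _) (inj₂ _) _ = tt
  A-sym (inj₂ _) (inj₁ _) _ = tt
  A-sym (inj₂ _) (inj₂ _) = sym G₂

  A-irrefl : ∀ u → ¬ A u u
  A-irrefl (inj₁ _) = irrefl G₁ refl
  A-irrefl (inj₂ _) = irrefl G₂ refl

C₅ : Graph
C₅ = record
  { Vertex = Fin 5
  ; order  = 5
  ; finite = ↔-refl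
  ; Adj    = A
  ; adj?   = A?
  ; sym    = swap
  ; irrefl = λ { {u} refl → from-yes (all? λ v → ¬? (A? v v)) u }
  }
  where
  next : Fin 5 → Fin 5
  next u = suc (toℕ u) mod 5

  A : Rel (Fin 5) 0ℓ
  A u v = v ≡ next u ⊎ u ≡ next v

  A? : Decidable A
  A? u v = (v ≟ next u) ⊎-dec (u ≟ next v)

-- A colouring of the (undirected) edges in r colours. Since p and q are
-- arbitrary, `undirected` also makes the colour independent of the adjacency
-- proof: colour u v p ≡ colour v u q ≡ colour u v p′.
record EdgeColouring (G : Graph) (r : ℕ) : Set where
  field
    colour     : ∀ u v → Adj G u v → Fin r
    undirected : ∀ u v (p : Adj G u v) (q : Adj G v u) →
                 colour u v p ≡ colour v u q

-- A k-clique, with its vertices listed in some order. They are distinct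
-- because Adj is irreflexive.
record Clique (G : Graph) (k : ℕ) : Set where
  field
    vertex   : Fin k → Vertex G
    adjacent : ∀ i j → i ≢ j → Adj G (vertex i) (vertex j)

Monochromatic : ∀ {G r k} → EdgeColouring G r → Fin r → Clique G k → Set
Monochromatic χ c K =
  ∀ i j (i≢j : i ≢ j) → colour (vertex i) (vertex j) (adjacent i j i≢j) ≡ c
  where
  open EdgeColouring χ
  open Clique K

infix 4 _→ₑ_

_→ₑ_ : ∀ {r} → Graph → Vec ℕ r → Set
_→ₑ_ {r} G a =
  (χ : EdgeColouring G r) →
  ∃[ i ] Σ[ K ∈ Clique G (lookup a i) ] Monochromatic χ i K

{-# OPTIONS --safe #-}

-- Suppose H has no monochromatic triangle. The set A of i-coloured neighbours of a
-- vertex v spans no edge of colour i, so A contains neither K₆ nor C₅ + K₃. Hence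
-- the chromatic number of A, a sum over the copies of C₅, is at most 5 unless A
-- consists of exactly two full copies D and D′ (then it is 6). The three colours
-- at v share chromatic number at least 5·3 + 1 = 16, so for every v the exceptional
-- case occurs in some colour i: v "sees" D and D′. All edges inside D and D′ then
-- have a common colour c ≠ i.
--
-- If a vertex of a c-monochromatic copy sees c-monochromatic copies, there are at
-- least four such copies, every vertex sees two of them, and counting the edges of
-- colour c between these copies and the remaining ones from both sides gives a
-- contradiction. Otherwise following what is seen closes up into a 4-cycle of
-- copies, and a vertex outside that cycle can see nothing.
module Submission where

open import Defs
open import Data.Bool using (Bool; true; false; if_then_else_)
import Data.Bool as Bool
open import Data.Empty using (⊥)
open import Data.Fin using (Fin; toℕ; _≟_)
open import Data.Fin.Patterns using (0F; 1F; 2F; 3F; 4F; 5F)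
open import Data.Fin.Properties using (all?; any?; injective⇒≤; punchInᵢ≢i)
open import Data.List using (List; []; _∷_; length; filter; concat; tabulate; map)
open import Data.List.Membership.DecPropositional using () renaming (_∈?_ to member?)
open import Data.List.Membership.Propositional using (_∈_; _∉_)
open import Data.List.Membership.Setoid.Properties using (index-injective)
open import Data.List.Properties using (length-++)
open import Data.List.Relation.Unary.All as All using (All; []; _∷_)
import Data.List.Relation.Unary.All.Properties as All
open import Data.List.Relation.Unary.AllPairs as AllPairs using (AllPairs; []; _∷_)
import Data.List.Relation.Unary.AllPairs.Properties as AllPairs
open import Data.List.Relation.Unary.Any using (here; there)
open import Data.List.Relation.Unary.Unique.Propositional using (Unique)
open import Data.Nat using (ℕ; zero; suc; _+_; _*_; _≤_; _<_; z≤n; s≤s; _≤?_)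
open import Data.Nat.DivMod using (_mod_)
import Data.Nat.ListAction as List
open import Data.Nat.Properties as ℕ
  using (≤-refl; ≤-trans; ≤-reflexive; ≰⇒>; <⇒≱; +-mono-≤; +-monoˡ-≤; +-monoʳ-≤; +-identityʳ; +-*-semiring)
open import Data.Product using (∃-syntax; Σ-syntax; _×_; _,_; proj₁; proj₂)
open import Data.Sum as Sum using (_⊎_; inj₁; inj₂; [_,_]′)
open import Data.Vec using (lookup; []; _∷_)
open import Data.Vec.Functional using (Vector; removeAt)
open import Function using (_∘_; case_of_; const)
open import Level using (0ℓ)
open import Relation.Binary.PropositionalEquality
  using (_≡_; _≢_; refl; sym; trans; cong; cong₂; subst; setoid; ≢-sym; module ≡-Reasoning)
open import Relation.Nullary using (¬_; Dec; yes; no; does; contradiction)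
open import Relation.Nullary.Decidable
  using (¬?; _→-dec_; _×-dec_; map′; toWitness; decidable-stable; dec-true; dec-false)
open import Relation.Unary using (Pred; Decidable)
open import Algebra.Properties.Semiring.Sum +-*-semiring
  using (sum; sum-syntax; sum-remove; sum-cong-≗; ∑-distrib-+; ∑-comm; *-distribʳ-sum)
open Graph using (Vertex; Adj; adj?)

≢-trans : {A : Set} {x y z : A} → x ≡ y → x ≢ z → y ≢ z
≢-trans refl x≢z = x≢z

-- Three colours

Colour : Set
Colour = Fin 3

third-unique : {i j k : Colour} → i ≢ j → i ≢ k → j ≢ k →
               ∀ {c} → c ≢ i → c ≢ j → c ≡ k
third-unique {i} {j} {k} i≢j i≢k j≢k {c} = table i j k c i≢j i≢k j≢k
  where
  table : (i j k c : Colour) → i ≢ j → i ≢ k → j ≢ k → c ≢ i → c ≢ j → c ≡ k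
  table = toWitness {a? = all? λ i → all? λ j → all? λ k → all? λ c →
    ¬? (i ≟ j) →-dec ¬? (i ≟ k) →-dec ¬? (j ≟ k) →-dec
    ¬? (c ≟ i) →-dec ¬? (c ≟ j) →-dec (c ≟ k)} _

third : {i j : Colour} → i ≢ j → ∃[ k ] (i ≢ k × j ≢ k)
third {i} {j} = table i j
  where
  table : (i j : Colour) → i ≢ j → ∃[ k ] (i ≢ k × j ≢ k)
  table = toWitness {a? = all? λ i → all? λ j →
    ¬? (i ≟ j) →-dec any? λ k → ¬? (i ≟ k) ×-dec ¬? (j ≟ k)} _

-- Colourings of C₅

next : Fin 5 → Fin 5
next u = suc (toℕ u) mod 5

-- `C₅` is not bipartite, so a predicate cannot alternate around it.
odd-cycle : {P : Pred (Fin 5) 0ℓ} → Decidable P →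
            ∃[ u ] ((P u × P (next u)) ⊎ (¬ P u × ¬ P (next u)))
odd-cycle P? with P? 0F | P? 1F | P? 2F | P? 3F | P? 4F
... | yes p | yes q | _     | _     | _     = 0F , inj₁ (p , q)
... | no p  | no q  | _     | _     | _     = 0F , inj₂ (p , q)
... | _     | yes p | yes q | _     | _     = 1F , inj₁ (p , q)
... | _     | no p  | no q  | _     | _     = 1F , inj₂ (p , q)
... | _     | _     | yes p | yes q | _     = 2F , inj₁ (p , q)
... | _     | _     | no p  | no q  | _     = 2F , inj₂ (p , q)
... | _     | _     | _     | yes p | yes q = 3F , inj₁ (p , q)
... | _     | _     | _     | no p  | no q  = 3F , inj₂ (p , q)
... | yes p | _     | _     | _     | yes q = 4F , inj₁ (q , p)
... | no p  | _     | _     | _     | no q  = 4F , inj₂ (q , p)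

constant-on-cycle : {A : Set} (f : Fin 5 → A) → (∀ u → f u ≡ f (next u)) → ∀ u → f u ≡ f 0F
constant-on-cycle f eq 0F = refl
constant-on-cycle f eq 1F = sym (eq 0F)
constant-on-cycle f eq 2F = trans (sym (eq 1F)) (sym (eq 0F))
constant-on-cycle f eq 3F = trans (eq 3F) (eq 4F)
constant-on-cycle f eq 4F = eq 4F

length-filter-∁ : {A : Set} {P : Pred A 0ℓ} (P? : Decidable P) (xs : List A) →
                  length xs ≡ length (filter P? xs) + length (filter (¬? ∘ P?) xs)
length-filter-∁ P? [] = refl
length-filter-∁ P? (x ∷ xs) with P? x
... | yes _ = cong suc (length-filter-∁ P? xs)
... | no  _ = trans (cong suc (length-filter-∁ P? xs)) (sym (ℕ.+-suc _ _))

abstract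
  -- If every element occurred, taking positions would inject `Fin n` into fewer than `n` places.
  ∉-short : ∀ {n} (xs : List (Fin n)) → length xs < n → ∃[ x ] x ∉ xs
  ∉-short {n} xs short with any? (λ x → ¬? (member? _≟_ x xs))
  ... | yes found = found
  ... | no none   = contradiction
    (injective⇒≤ λ {x} {y} → index-injective (setoid (Fin n)) (covered x) (covered y))
    (<⇒≱ short)
    where
    covered : ∀ x → x ∈ xs
    covered x = decidable-stable (member? _≟_ x xs) (λ x∉ → none (x , x∉))

-- Finite sums

sum-mono : ∀ {n} {f g : Vector ℕ n} → (∀ x → f x ≤ g x) → sum f ≤ sum g
sum-mono {zero}  f≤g = z≤n
sum-mono {suc n} f≤g = +-mono-≤ (f≤g 0F) (sum-mono (f≤g ∘ Fin.suc))

-- Zeroing an entry keeps the index type, so distinct entries can be split off a sum one after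
-- another.
clear : ∀ {n} → Fin n → Vector ℕ n → Vector ℕ n
clear x f y = if does (y ≟ x) then 0 else f y

clear-≢ : ∀ {n} {x y : Fin n} (f : Vector ℕ n) → y ≢ x → clear x f y ≡ f y
clear-≢ {x = x} {y} f y≢x rewrite dec-false (y ≟ x) y≢x = refl

sum-clear : ∀ {n} (x : Fin n) (f : Vector ℕ n) → sum f ≡ f x + sum (clear x f)
sum-clear {suc n} x f = begin
  sum f                                               ≡⟨ sum-remove f ⟩
  f x + sum (removeAt f x)                            ≡⟨ cong (f x +_) (sum-cong-≗ λ y → clear-≢ f (punchInᵢ≢i x y)) ⟨
  f x + sum (removeAt (clear x f) x)                  ≡⟨ cong (λ b → f x + ((if b then 0 else f x) + sum (removeAt (clear x f) x))) (dec-true (x ≟ x) refl) ⟨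
  f x + (clear x f x + sum (removeAt (clear x f) x))  ≡⟨ cong (f x +_) (sum-remove (clear x f)) ⟨
  f x + sum (clear x f)                               ∎
  where open ≡-Reasoning

sum-unique-≤ : ∀ {n} (f : Vector ℕ n) {xs : List (Fin n)} → Unique xs → List.sum (map f xs) ≤ sum f
sum-unique-≤ f [] = z≤n
sum-unique-≤ f {x ∷ xs} (x∉xs ∷ xs!) = begin
  f x + List.sum (map f xs)            ≡⟨ cong (f x +_) (agree x∉xs) ⟨
  f x + List.sum (map (clear x f) xs)  ≤⟨ +-monoʳ-≤ (f x) (sum-unique-≤ (clear x f) xs!) ⟩
  f x + sum (clear x f)                ≡⟨ sum-clear x f ⟨
  sum f                                ∎
  where
  open ℕ.≤-Reasoning
  agree : ∀ {ys} → All (x ≢_) ys → List.sum (map (clear x f) ys) ≡ List.sum (map f ys)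
  agree []         = refl
  agree (x≢y ∷ ps) = cong₂ _+_ (clear-≢ f (≢-sym x≢y)) (agree ps)

length-concat-≥ : ∀ {A : Set} {n} (f : Vector ℕ n) (xss : Fin n → List A) →
                  (∀ x → f x ≤ length (xss x)) → sum f ≤ length (concat (tabulate xss))
length-concat-≥ {n = zero}  f xss f≤ = z≤n
length-concat-≥ {n = suc n} f xss f≤ = ≤-trans
  (+-mono-≤ (f≤ 0F) (length-concat-≥ (f ∘ Fin.suc) (xss ∘ Fin.suc) (f≤ ∘ Fin.suc)))
  (≤-reflexive (sym (length-++ (xss 0F))))

-- One colour on a 5-cycle

𝟙 : ∀ {A : Set} → Dec A → ℕ
𝟙 a? = if does a? then 1 else 0

-- Below, weight i f is the chromatic number of the subgraph of C₅ induced by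
-- { u | f u ≡ i }.
weightᵇ : Bool → Bool → Bool → ℕ
weightᵇ true  _     _     = 3
weightᵇ false true  _     = 2
weightᵇ false false true  = 1
weightᵇ false false false = 0

module _ (i : Colour) (f : Fin 5 → Colour) where

  Full Edge Point : Set
  Full  = ∀ u → f u ≡ i
  Edge  = ∃[ u ] (f u ≡ i × f (next u) ≡ i)
  Point = ∃[ u ] f u ≡ i

  full? : Dec Full
  full? = all? λ u → f u ≟ i

  edge? : Dec Edge
  edge? = any? λ u → (f u ≟ i) ×-dec (f (next u) ≟ i)

  point? : Dec Point
  point? = any? λ u → f u ≟ i

  count : ℕ
  count = ∑[ u < 5 ] 𝟙 (f u ≟ i)

  weight : ℕ
  weight = weightᵇ (does full?) (does edge?) (does point?)

  -- Indexed by the weight, so that matching on `weight i f` together with `profile i f` yields both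
  -- its value and a reason for it.
  data Profile : ℕ → Set where
    full  : Full → Profile 3
    edge  : Edge → Profile 2
    point : Point → ¬ Edge → Profile 1
    empty : ¬ Point → Profile 0

  profile : Profile weight
  profile = classify full? edge? point?
    where
    classify : (a? : Dec Full) (b? : Dec Edge) (c? : Dec Point) →
               Profile (weightᵇ (does a?) (does b?) (does c?))
    classify (yes a) _       _       = full a
    classify (no _)  (yes b) _       = edge b
    classify (no _)  (no ¬b) (yes c) = point c ¬b
    classify (no _)  (no _)  (no ¬c) = empty ¬c

-- `weight i f` and `count i f` inspect f only at the five literals, so they are
-- definitionally equal to their values at `row (f 0F) … (f 4F)`; this is what
-- lets a table over all rows apply to an arbitrary f.
row : (a b c d e : Colour) → Fin 5 → Colour
row a b c d e = lookup (a ∷ b ∷ c ∷ d ∷ e ∷ [])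

-- Proper colourings of the three classes with disjoint palettes combine to one of `C₅`, whose
-- chromatic number is 3.
weight-cover : ∀ {i j k} → i ≢ j → i ≢ k → j ≢ k → ∀ f → 3 ≤ weight i f + (weight j f + weight k f)
weight-cover {i} {j} {k} i≢j i≢k j≢k f = table i j k i≢j i≢k j≢k (f 0F) (f 1F) (f 2F) (f 3F) (f 4F)
  where
  table : (i j k : Colour) → i ≢ j → i ≢ k → j ≢ k → (a b c d e : Colour) →
          3 ≤ weight i (row a b c d e) + (weight j (row a b c d e) + weight k (row a b c d e))
  table = toWitness {a? = all? λ i → all? λ j → all? λ k →
    ¬? (i ≟ j) →-dec ¬? (i ≟ k) →-dec ¬? (j ≟ k) →-dec
    (all? λ a → all? λ b → all? λ c → all? λ d → all? λ e → 3 ≤? _)} _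

weight≤count : ∀ i f → weight i f ≤ count i f
weight≤count i f = table i (f 0F) (f 1F) (f 2F) (f 3F) (f 4F)
  where
  table : (i a b c d e : Colour) → weight i (row a b c d e) ≤ count i (row a b c d e)
  table = toWitness {a? = all? λ i → all? λ a → all? λ b → all? λ c → all? λ d → all? λ e → _ ≤? _} _

-- The independence number of `C₅` is 2.
count≤2 : ∀ i f → ¬ Edge i f → count i f ≤ 2
-- Unlike `Edge i f`, the Boolean is definitionally the same for `f` and for its row.
count≤2 i f ¬edge = table i (f 0F) (f 1F) (f 2F) (f 3F) (f 4F) (dec-false (edge? i f) ¬edge)
  where
  table : (i a b c d e : Colour) → does (edge? i (row a b c d e)) ≡ false → count i (row a b c d e) ≤ 2
  table = toWitness {a? = all? λ i → all? λ a → all? λ b → all? λ c → all? λ d → all? λ e →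
    (does (edge? i (row a b c d e)) Bool.≟ false) →-dec _ ≤? 2} _

weight-none : ∀ {i f} → ¬ Point i f → weight i f ≡ 0
weight-none {i} {f} none with weight i f | profile i f
... | _ | full f≡       = contradiction (0F , f≡ 0F) none
... | _ | edge (u , e , _) = contradiction (u , e) none
... | _ | point p _     = contradiction p none
... | _ | empty _       = refl

weight≤1 : ∀ {i f} → ¬ Full i f → ¬ Edge i f → weight i f ≤ 1
weight≤1 {i} {f} ¬full ¬edge with weight i f | profile i f
... | _ | full f≡   = contradiction f≡ ¬full
... | _ | edge e    = contradiction e ¬edge
... | _ | point _ _ = ≤-refl
... | _ | empty _   = z≤n

count-none : ∀ {i f} → ¬ Point i f → count i f ≤ 0
count-none {i} {f} none = sum-mono {g = const 0} λ u →
  ≤-reflexive (cong (if_then 1 else 0) (dec-false (f u ≟ i) λ e → none (u , e)))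

count-full : ∀ {i f} → Full i f → 5 ≤ count i f
count-full {i} {f} f≡ = sum-mono {f = const 1} λ u →
  ≤-reflexive (sym (cong (if_then 1 else 0) (dec-true (f u ≟ i) (f≡ u))))

-- The graph on six copies of C₅

Copy : Set
Copy = Fin 6

V : Set
V = Copy × Fin 5

infix 4 _~_

-- Indexing the copies by `Fin 6` treats them alike, unlike the nested sums of `H`; `vertexOf-adj`
-- carries adjacency over at the end.
data _~_ : V → V → Set where
  across : ∀ {X Y u v} → X ≢ Y → (X , u) ~ (Y , v)
  within : ∀ {X u v} → Adj C₅ u v → (X , u) ~ (X , v)

~-sym : ∀ {x y} → x ~ y → y ~ x
~-sym (across X≢Y) = across (≢-sym X≢Y)
~-sym (within a)   = within (Graph.sym C₅ a)

step : ∀ {X u} → (X , u) ~ (X , next u)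
step = within (inj₁ refl)

-- Two-coloured neighbourhoods

module TriangleFree
  (col     : V → V → Colour)
  (col-sym : ∀ x y → col x y ≡ col y x)
  (no-triangle : ∀ {c x y z} → x ~ y → x ~ z → y ~ z →
                 col x y ≡ c → col x z ≡ c → col y z ≢ c)
  where

  flip : ∀ {x y c} → col x y ≡ c → col y x ≡ c
  flip {x} {y} = trans (col-sym y x)

  record _∈N[_,_] (x v : V) (i : Colour) : Set where
    constructor nbr
    field
      adj    : v ~ x
      colour : col v x ≡ i

  avoids : ∀ {v i x y} → x ∈N[ v , i ] → y ∈N[ v , i ] → x ~ y → col x y ≢ i
  avoids (nbr vx cx) (nbr vy cy) xy = no-triangle vx vy xy cx cy

  module _ {v : V} {i : Colour} where

    -- The edges among a, b, c avoid j because of p and i because of v, so all three have the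
    -- remaining colour.
    no-star : ∀ {j p a b c} → p ∈N[ v , i ] → a ∈N[ v , i ] → b ∈N[ v , i ] → c ∈N[ v , i ] →
              p ~ a → p ~ b → p ~ c → a ~ b → a ~ c → b ~ c →
              col p a ≡ j → col p b ≡ j → col p c ≢ j
    no-star {j} Np Na Nb Nc pa pb pc ab ac bc ea eb ec
      with j≢i ← ≢-trans ea (avoids Np Na pa)
      with k , j≢k , i≢k ← third {j} {i} j≢i
      = no-triangle ab ac bc
          (third-unique j≢i j≢k i≢k (no-triangle pa pb ab ea eb) (avoids Na Nb ab))
          (third-unique j≢i j≢k i≢k (no-triangle pa pc ac ea ec) (avoids Na Nc ac))
          (third-unique j≢i j≢k i≢k (no-triangle pb pc bc eb ec) (avoids Nb Nc bc))

    -- Only two colours occur inside the neighbourhood, so this is R(3,3) = 6: of five edges at p,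
    -- three share a colour.
    no-K₆ : (xs : List V) → All (_∈N[ v , i ]) xs → AllPairs _~_ xs → ¬ 6 ≤ length xs
    no-K₆ (p ∷ xs@(q ∷ _)) (Np ∷ Nxs@(Nq ∷ _)) (p~xs@(p~q ∷ _) ∷ xs~) (s≤s 5≤)
      -- The edge `p q` serves to name a colour other than i.
      with j ← col p q | j≢i ← avoids Np Nq p~q
      with k , j≢k , i≢k ← third {j} {i} j≢i =
      [ no-three (filter j? xs) (All.filter⁺ j? Nxs) (All.filter⁺ j? p~xs)
          (AllPairs.filter⁺ j? xs~) (All.all-filter j? xs)
      , no-three (filter (¬? ∘ j?) xs) (All.filter⁺ (¬? ∘ j?) Nxs) (All.filter⁺ (¬? ∘ j?) p~xs)
          (AllPairs.filter⁺ (¬? ∘ j?) xs~)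
          (All.zipWith (λ (≢j , ≢i) → third-unique j≢i j≢k i≢k ≢j ≢i)
            (All.all-filter (¬? ∘ j?) xs , All.filter⁺ (¬? ∘ j?) (All.zipWith (λ (Ny , py) → avoids Np Ny py) (Nxs , p~xs))))
      ]′ (half (subst (5 ≤_) (length-filter-∁ j? xs) 5≤))
      where
      j? : ∀ y → _
      j? y = col p y ≟ j

      half : ∀ {m n} → 5 ≤ m + n → 3 ≤ m ⊎ 3 ≤ n
      half {0} (s≤s (s≤s (s≤s _))) = inj₂ (s≤s (s≤s (s≤s z≤n)))
      half {1} (s≤s (s≤s (s≤s (s≤s _)))) = inj₂ (s≤s (s≤s (s≤s z≤n)))
      half {2} (s≤s (s≤s 3≤)) = inj₂ 3≤
      half {suc (suc (suc _))} _ = inj₁ (s≤s (s≤s (s≤s z≤n)))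

      no-three : ∀ {j} ys → All (_∈N[ v , i ]) ys → All (p ~_) ys → AllPairs _~_ ys →
                 All (λ y → col p y ≡ j) ys → ¬ 3 ≤ length ys
      no-three (_ ∷ _ ∷ _ ∷ _) (Na ∷ Nb ∷ Nc ∷ _) (pa ∷ pb ∷ pc ∷ _)
        ((ab ∷ ac ∷ _) ∷ (bc ∷ _) ∷ _) (ea ∷ eb ∷ ec ∷ _) _ =
        no-star Np Na Nb Nc pa pb pc ab ac bc ea eb ec
      no-three (_ ∷ _ ∷ []) _ _ _ _ (s≤s (s≤s ()))
      no-three (_ ∷ []) _ _ _ _ (s≤s ())

    -- Here `b c` gets the second available colour k. A j-edge from D to a would force a k-triangle
    -- on b and c, so a sends only k to D, and D is coloured j inside. By parity, two consecutive
    -- vertices of D both send j to b, or both send k to b and hence j to c; either way a j-triangle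
    -- arises.
    cone : ∀ {D j a b c} → (∀ u → (D , u) ∈N[ v , i ]) →
           a ∈N[ v , i ] → b ∈N[ v , i ] → c ∈N[ v , i ] →
           a ~ b → a ~ c → b ~ c →
           (∀ u → (D , u) ~ a) → (∀ u → (D , u) ~ b) → (∀ u → (D , u) ~ c) →
           col a b ≡ j → col a c ≢ j
    cone {D} {j} {a} {b} {c} ND Na Nb Nc ab ac bc Da Db Dc eb ec
      with j≢i ← ≢-trans eb (avoids Na Nb ab)
      with k , j≢k , i≢k ← third {j} {i} j≢i
      = case odd-cycle (λ u → col (D , u) b ≟ j) of λ where
          (u , inj₁ (e , e′)) → no-triangle step (Db u) (Db (next u)) (inner-j u) e e′
          (u , inj₂ (e , e′)) → no-triangle step (Dc u) (Dc (next u)) (inner-j u) (to-c u e) (to-c (next u) e′)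
      where
      is-k : ∀ {x y} → x ∈N[ v , i ] → y ∈N[ v , i ] → x ~ y → col x y ≢ j → col x y ≡ k
      is-k Nx Ny xy ≢j = third-unique j≢i j≢k i≢k ≢j (avoids Nx Ny xy)

      bc-k : col b c ≡ k
      bc-k = is-k Nb Nc bc (no-triangle ab ac bc eb ec)

      apex-k : ∀ u → col (D , u) a ≡ k
      apex-k u = is-k (ND u) Na (Da u) λ e → no-triangle (Db u) (Dc u) bc
        (is-k (ND u) Nb (Db u) (no-triangle (~-sym (Da u)) ab (Db u) (flip e) eb))
        (is-k (ND u) Nc (Dc u) (no-triangle (~-sym (Da u)) ac (Dc u) (flip e) ec))
        bc-k

      inner-j : ∀ u → col (D , u) (D , next u) ≡ j
      inner-j u = third-unique (≢-sym i≢k) (≢-sym j≢k) (≢-sym j≢i)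
        (no-triangle (~-sym (Da u)) (~-sym (Da (next u))) step (flip (apex-k u)) (flip (apex-k (next u))))
        (avoids (ND u) (ND (next u)) step)

      to-c : ∀ u → col (D , u) b ≢ j → col (D , u) c ≡ j
      to-c u ub = third-unique (≢-sym i≢k) (≢-sym j≢k) (≢-sym j≢i)
        (λ uc → no-triangle (Db u) (Dc u) bc (is-k (ND u) Nb (Db u) ub) uc bc-k)
        (avoids (ND u) Nc (Dc u))

    -- With two colours available, two edges of the triangle a b c agree; their common vertex
    -- becomes the apex of `cone`.
    no-C₅+K₃ : ∀ {D a b c} → (∀ u → (D , u) ∈N[ v , i ]) →
               a ∈N[ v , i ] → b ∈N[ v , i ] → c ∈N[ v , i ] →
               a ~ b → a ~ c → b ~ c →
               (∀ u → (D , u) ~ a) → (∀ u → (D , u) ~ b) → ¬ (∀ u → (D , u) ~ c)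
    no-C₅+K₃ {D} {a} {b} {c} ND Na Nb Nc ab ac bc Da Db Dc
      with col a b ≟ col a c | col a b ≟ col b c
    ... | yes e | _     = cone ND Na Nb Nc ab ac bc Da Db Dc e refl
    ... | no _  | yes e = cone ND Nb Na Nc (~-sym ab) bc ac Db Da Dc (flip e) refl
    ... | no ≢ac | no ≢bc = cone ND Nc Na Nb (~-sym ac) (~-sym bc) ab Dc Da Db (flip eq) (flip refl)
      where
      eq : col a c ≡ col b c
      eq = sym (third-unique (≢-sym (avoids Na Nb ab)) (≢-sym (avoids Na Nc ac)) ≢ac
             (avoids Nb Nc bc) (≢-sym ≢bc))

  -- Pairs of copies seen in one colour

  line : V → Copy → Fin 5 → Colour
  line v Y u = col v (Y , u)

  Mono : Colour → Copy → Set
  Mono c X = ∀ u → col (X , u) (X , next u) ≡ c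

  -- abstract: `with mono? c X` could not match its unfolded `does`.
  abstract
    mono? : ∀ c X → Dec (Mono c X)
    mono? c X = all? λ u → col (X , u) (X , next u) ≟ c

  mono-unique : ∀ {c c′ X} → Mono c X → Mono c′ X → c ≡ c′
  mono-unique m m′ = trans (sym (m 0F)) (m′ 0F)

  mono⇒¬edge : ∀ {c v X} → proj₁ v ≢ X → Mono c X → ¬ Edge c (line v X)
  mono⇒¬edge v∉X m (u , e , e′) = no-triangle (across v∉X) (across v∉X) step e e′ (m u)

  -- The i-coloured neighbours of v are exactly the copies D and D′; of the two
  -- neighbours of v in its own copy it is enough to exclude one.
  record Sees (v : V) (i : Colour) (D D′ : Copy) : Set where
    field
      D∌v  : proj₁ v ≢ D
      D′∌v : proj₁ v ≢ D′
      D≢D′ : D ≢ D′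
      onto  : Full i (line v D)
      onto′ : Full i (line v D′)
      only  : ∀ {Y u} → proj₁ v ≢ Y → col v (Y , u) ≡ i → Y ≡ D ⊎ Y ≡ D′
      own   : col v (proj₁ v , next (proj₂ v)) ≢ i

  open Sees

  sees-swap : ∀ {v i D D′} → Sees v i D D′ → Sees v i D′ D
  sees-swap s = record
    { D∌v = D′∌v s ; D′∌v = D∌v s ; D≢D′ = ≢-sym (D≢D′ s) ; onto = onto′ s ; onto′ = onto s
    ; only = λ v∉Y e → Sum.swap (only s v∉Y e) ; own = own s }

  module _ {v i D D′} (D≢D′ : D ≢ D′)
           (ND : ∀ u → (D , u) ∈N[ v , i ]) (ND′ : ∀ u → (D′ , u) ∈N[ v , i ]) where

    private
      D~D′ : ∀ {u y} → (D , u) ~ (D′ , y)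
      D~D′ = across D≢D′

    -- In a K₄ formed by an edge of D and an edge of D′ of different colours, the
    -- four cross edges alternate.
    alternate : ∀ {u w y} → (D , u) ~ (D , w) →
                col (D , u) (D , w) ≢ col (D′ , y) (D′ , next y) →
                col (D , u) (D′ , y) ≢ col (D , u) (D′ , next y)
    alternate {u} {w} {y} uw j≢k eq =
      -- Equal cross edges at u either have the colour of `u w`, and then both cross edges at w take
      -- the colour of the edge of D′, or they have that colour themselves; both cases close a
      -- triangle on the edge of D′.
      case col (D , u) (D′ , y) ≟ col (D , u) (D , w) of λ where
        (yes uy) → no-triangle D~D′ D~D′ step
          (is-k w y (no-triangle uw D~D′ D~D′ refl uy))
          (is-k w (next y) (no-triangle uw D~D′ D~D′ refl (trans (sym eq) uy)))
          refl
        (no uy) → no-triangle D~D′ D~D′ step (is-k u y uy) (trans (sym eq) (is-k u y uy)) refl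
      where
      is-k : ∀ x y′ → col (D , x) (D′ , y′) ≢ col (D , u) (D , w) →
             col (D , x) (D′ , y′) ≡ col (D′ , y) (D′ , next y)
      is-k x y′ ≢j = third-unique (≢-sym (avoids (ND u) (ND w) uw))
        (≢-sym (avoids (ND′ y) (ND′ (next y)) step)) j≢k
        (avoids (ND x) (ND′ y′) D~D′) ≢j

    -- The cross edges at u avoid i, and the two colours left cannot alternate around an odd cycle.
    no-alternation : ∀ u → ¬ (∀ y → col (D , u) (D′ , y) ≢ col (D , u) (D′ , next y))
    no-alternation u alt = case odd-cycle (λ y → col (D , u) (D′ , y) ≟ col (D , u) (D′ , 0F)) of λ where
        (y , inj₁ (e , e′)) → alt y (trans e (sym e′))
        (y , inj₂ (e , e′)) → alt y (third-unique (≢-sym (N≢ 0F)) (≢-sym (N≢ (next y))) (≢-sym e′) (N≢ y) e)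
      where
      N≢ : ∀ y → col (D , u) (D′ , y) ≢ i
      N≢ y = avoids (ND u) (ND′ y) D~D′

    -- If the edges of D on either side of `next u` differed, each edge of D′ would differ from one
    -- of them, and by `alternate` the cross edges at `next u` would alternate around D′.
    monochrome : Mono (col (D , 0F) (D , 1F)) D
    monochrome = constant-on-cycle (λ u → col (D , u) (D , next u)) λ u →
      decidable-stable (_ ≟ _) λ differ → no-alternation (next u) λ y →
        case col (D , next u) (D , u) ≟ col (D′ , y) (D′ , next y) of λ where
          (yes e) → alternate step (λ e′ → differ (trans (trans (flip refl) e) (sym e′)))
          (no ≢)  → alternate (~-sym step) ≢

    same-colour : (∀ y → col (D′ , y) (D′ , next y) ≡ col (D′ , 0F) (D′ , 1F)) →
                  col (D , 0F) (D , 1F) ≡ col (D′ , 0F) (D′ , 1F)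
    same-colour mono′ = decidable-stable (_ ≟ _) λ differ → no-alternation 0F λ y →
      alternate step λ e → differ (trans e (mono′ y))

  seen-nbr : ∀ {v i D} → proj₁ v ≢ D → Full i (line v D) → ∀ u → (D , u) ∈N[ v , i ]
  seen-nbr v∉D f u = nbr (across v∉D) (f u)

  abstract
    sees-mono : ∀ {v i D D′} → Sees v i D D′ → ∃[ c ] (c ≢ i × Mono c D × Mono c D′)
    sees-mono {v} {i} {D} {D′} s =
      col (D′ , 0F) (D′ , 1F) , avoids (ND′ 0F) (ND′ 1F) step ,
      (λ u → trans (monochrome (D≢D′ s) ND ND′ u) (same-colour (D≢D′ s) ND ND′ mono′)) , mono′
      where
      ND : ∀ u → (D , u) ∈N[ v , i ]
      ND = seen-nbr (D∌v s) (onto s)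
      ND′ : ∀ u → (D′ , u) ∈N[ v , i ]
      ND′ = seen-nbr (D′∌v s) (onto′ s)
      mono′ : Mono (col (D′ , 0F) (D′ , 1F)) D′
      mono′ = monochrome (≢-sym (D≢D′ s)) ND′ ND

  -- Any further i-coloured neighbour would form, with an edge of D′, a triangle joined to all of D.
  fulls⇒sees : ∀ {v i D D′} → proj₁ v ≢ D → proj₁ v ≢ D′ → D ≢ D′ →
               Full i (line v D) → Full i (line v D′) → Sees v i D D′
  fulls⇒sees {v@(X , x)} {i} {D} {D′} v∉D v∉D′ D≢ f f′ = record
    { D∌v = v∉D ; D′∌v = v∉D′ ; D≢D′ = D≢ ; onto = f ; onto′ = f′
    ; only = λ {Y} {u} v∉Y e → case Y ≟ D of λ where
        (yes Y≡D) → inj₁ Y≡D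
        (no Y≢D)  → inj₂ (decidable-stable (Y ≟ D′) λ Y≢D′ →
          no-third (≢-sym Y≢D) (≢-sym Y≢D′) (nbr (across v∉Y) e))
    ; own = λ e → no-third (≢-sym v∉D) (≢-sym v∉D′) (nbr step e) }
    where
    no-third : ∀ {Y u} → D ≢ Y → D′ ≢ Y → ¬ (Y , u) ∈N[ v , i ]
    no-third D≢Y D′≢Y Nz = no-C₅+K₃ (seen-nbr v∉D f)
      (nbr (across v∉D′) (f′ 0F)) (nbr (across v∉D′) (f′ 1F)) Nz
      step (across D′≢Y) (across D′≢Y)
      (λ _ → across D≢) (λ _ → across D≢) (λ _ → across D≢Y)

  -- Every vertex sees two copies

  record LargeClique (Q : V → Set) (n : ℕ) : Set where
    field
      clique   : List V
      holds    : All Q clique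
      adjacent : AllPairs _~_ clique
      large    : n ≤ length clique

  open LargeClique

  -- Different copies are completely joined, so cliques chosen in each of them unite to one clique.
  gather : ∀ {Q} {f : Vector ℕ 6} → (∀ Y → LargeClique (λ x → Q x × proj₁ x ≡ Y) (f Y)) → LargeClique Q (sum f)
  gather {Q} {f} blocks = record
    { clique   = concat (tabulate (clique ∘ blocks))
    ; holds    = All.concat⁺ (All.tabulate⁺ (All.map proj₁ ∘ holds ∘ blocks))
    ; adjacent = AllPairs.concat⁺ (All.tabulate⁺ (adjacent ∘ blocks)) (AllPairs.tabulate⁺ λ {Y} {Z} Y≢Z →
        All.map (λ { (_ , refl) → All.map (λ { (_ , refl) → across Y≢Z }) (holds (blocks Z)) }) (holds (blocks Y)))
    ; large    = length-concat-≥ f (clique ∘ blocks) (large ∘ blocks)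
    }

  -- The copy of v contributes through the single neighbour `next x` only.
  nbrWeight : Colour → V → Vector ℕ 6
  nbrWeight i v@(X , x) Y = if does (X ≟ Y) then 𝟙 (col v (X , next x) ≟ i) else weight i (line v Y)

  FullFrom : Colour → V → Copy → Set
  FullFrom i v Y = proj₁ v ≢ Y × Full i (line v Y)

  fullFrom? : ∀ i v Y → Dec (FullFrom i v Y)
  fullFrom? i v Y = ¬? (proj₁ v ≟ Y) ×-dec full? i (line v Y)

  -- A proper induced subgraph of `C₅` is bipartite, so its chromatic number is attained by a
  -- clique.
  nbrWeight-block : ∀ i v Y → ¬ FullFrom i v Y → LargeClique (λ x → x ∈N[ v , i ] × proj₁ x ≡ Y) (nbrWeight i v Y)
  nbrWeight-block i v@(X , x) Y ¬full with X ≟ Y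
  ... | yes refl with col v (X , next x) ≟ i
  ...   | yes e = record { clique = (X , next x) ∷ [] ; holds = (nbr step e , refl) ∷ [] ; adjacent = [] ∷ [] ; large = ≤-refl }
  ...   | no  _ = record { clique = [] ; holds = [] ; adjacent = [] ; large = z≤n }
  nbrWeight-block i v@(X , x) Y ¬full | no X≢Y with weight i (line v Y) | profile i (line v Y)
  ... | _ | full f = contradiction (X≢Y , f) ¬full
  ... | _ | edge (u , e , e′) = record
    { clique = (Y , u) ∷ (Y , next u) ∷ []
    ; holds = (nbr (across X≢Y) e , refl) ∷ (nbr (across X≢Y) e′ , refl) ∷ []
    ; adjacent = (step ∷ []) ∷ [] ∷ [] ; large = ≤-refl }
  ... | _ | point (u , e) _ = record
    { clique = (Y , u) ∷ [] ; holds = (nbr (across X≢Y) e , refl) ∷ [] ; adjacent = [] ∷ [] ; large = ≤-refl }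
  ... | _ | empty _ = record { clique = [] ; holds = [] ; adjacent = [] ; large = z≤n }

  nbrWeight≤3 : ∀ i v Y → nbrWeight i v Y ≤ 3
  nbrWeight≤3 i v@(X , x) Y with X ≟ Y
  ... | yes _ with col v (X , next x) ≟ i
  ...   | yes _ = s≤s z≤n
  ...   | no _  = z≤n
  nbrWeight≤3 i v@(X , x) Y | no _ with weight i (line v Y) | profile i (line v Y)
  ... | _ | full _    = ≤-refl
  ... | _ | edge _    = s≤s (s≤s z≤n)
  ... | _ | point _ _ = s≤s z≤n
  ... | _ | empty _   = z≤n

  -- Without a full copy the weights are realised by a 6-clique. With exactly one, D, the others
  -- still weigh 3 and give a triangle joined to D. Hence two copies are full.
  heavy⇒sees : ∀ {i v} → 6 ≤ sum (nbrWeight i v) → ∃[ D ] ∃[ D′ ] Sees v i D D′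
  heavy⇒sees {i} {v} heavy with any? (fullFrom? i v)
  ... | no none = contradiction (≤-trans heavy (large K)) (no-K₆ (clique K) (holds K) (adjacent K))
    where
    K : LargeClique (_∈N[ v , i ]) (sum (nbrWeight i v))
    K = gather λ Y → nbrWeight-block i v Y (λ fl → none (Y , fl))
  ... | yes (D , v∉D , fD) with any? (λ D′ → ¬? (D ≟ D′) ×-dec fullFrom? i v D′)
  ...   | yes (D′ , D≢D′ , v∉D′ , fD′) = D , D′ , fulls⇒sees v∉D v∉D′ D≢D′ fD fD′
  ...   | no none = contradiction (≤-trans three (large K)) (no-K₃ (clique K) (holds K) (adjacent K))
    where
    no-K₃ : ∀ xs → All (λ x → x ∈N[ v , i ] × D ≢ proj₁ x) xs → AllPairs _~_ xs → ¬ 3 ≤ length xs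
    no-K₃ (a ∷ b ∷ c ∷ _) ((Na , Da) ∷ (Nb , Db) ∷ (Nc , Dc) ∷ _) ((ab ∷ ac ∷ _) ∷ (bc ∷ _) ∷ _) _ =
      no-C₅+K₃ (seen-nbr v∉D fD) Na Nb Nc ab ac bc (λ _ → across Da) (λ _ → across Db) (λ _ → across Dc)
    no-K₃ (_ ∷ _ ∷ []) _ _ (s≤s (s≤s ()))
    no-K₃ (_ ∷ []) _ _ (s≤s ())

    blocks : ∀ Y → LargeClique (λ x → (x ∈N[ v , i ] × D ≢ proj₁ x) × proj₁ x ≡ Y) (clear D (nbrWeight i v) Y)
    blocks Y with Y ≟ D
    ... | yes _  = record { clique = [] ; holds = [] ; adjacent = [] ; large = z≤n }
    ... | no Y≢D = record
      { clique   = clique B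
      ; holds    = All.map (λ { (Nx , refl) → (Nx , ≢-sym Y≢D) , refl }) (holds B)
      ; adjacent = adjacent B
      ; large    = large B }
      where B = nbrWeight-block i v Y λ fl → none (Y , ≢-sym Y≢D , fl)

    K : LargeClique (λ x → x ∈N[ v , i ] × D ≢ proj₁ x) (sum (clear D (nbrWeight i v)))
    K = gather blocks

    three : 3 ≤ sum (clear D (nbrWeight i v))
    three = ℕ.+-cancelˡ-≤ 3 3 _ (≤-trans (subst (6 ≤_) (sum-clear D (nbrWeight i v)) heavy)
      (+-monoˡ-≤ _ (nbrWeight≤3 i v D)))

  -- The copy of v contributes 1 through `next x`, and each of the other five at least 3 by
  -- `weight-cover`.
  nbrWeight-total : ∀ {i j k} → i ≢ j → i ≢ k → j ≢ k → ∀ v → 16 ≤ sum (nbrWeight i v) + (sum (nbrWeight j v) + sum (nbrWeight k v))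
  nbrWeight-total {i} {j} {k} i≢j i≢k j≢k v@(X , x) = begin
    16                                                                    ≡⟨ sum-base X ⟨
    sum base                                                              ≤⟨ sum-mono base≤ ⟩
    ∑[ Y < 6 ] (nbrWeight i v Y + (nbrWeight j v Y + nbrWeight k v Y))    ≡⟨ ∑-distrib-+ (nbrWeight i v) (λ Y → nbrWeight j v Y + nbrWeight k v Y) ⟩
    sum (nbrWeight i v) + ∑[ Y < 6 ] (nbrWeight j v Y + nbrWeight k v Y)  ≡⟨ cong (sum (nbrWeight i v) +_) (∑-distrib-+ (nbrWeight j v) (nbrWeight k v)) ⟩
    sum (nbrWeight i v) + (sum (nbrWeight j v) + sum (nbrWeight k v))     ∎
    where
    open ℕ.≤-Reasoning
    base : Vector ℕ 6
    base Y = if does (X ≟ Y) then 1 else 3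

    sum-base : ∀ X → ∑[ Y < 6 ] (if does (X ≟ Y) then 1 else 3) ≡ 16
    sum-base = toWitness {a? = all? λ X → _ ℕ.≟ 16} _

    cover : ∀ i j k c → i ≢ j → i ≢ k → j ≢ k → 1 ≤ 𝟙 (c ≟ i) + (𝟙 (c ≟ j) + 𝟙 (c ≟ k))
    cover = toWitness {a? = all? λ i → all? λ j → all? λ k → all? λ (c : Colour) →
      ¬? (i ≟ j) →-dec ¬? (i ≟ k) →-dec ¬? (j ≟ k) →-dec 1 ≤? _} _

    base≤ : ∀ Y → base Y ≤ nbrWeight i v Y + (nbrWeight j v Y + nbrWeight k v Y)
    base≤ Y with X ≟ Y
    ... | yes _ = cover i j k (col v (X , next x)) i≢j i≢k j≢k
    ... | no _  = weight-cover i≢j i≢k j≢k (line v Y)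

  abstract
    -- Three weights of at most 5 would total at most 15, short of 16.
    sees : ∀ v → ∃[ i ] ∃[ D ] ∃[ D′ ] Sees v i D D′
    sees v with 6 ≤? sum (nbrWeight 0F v) | 6 ≤? sum (nbrWeight 1F v) | 6 ≤? sum (nbrWeight 2F v)
    ... | yes h | _ | _ = 0F , heavy⇒sees h
    ... | no _ | yes h | _ = 1F , heavy⇒sees h
    ... | no _ | no _ | yes h = 2F , heavy⇒sees h
    ... | no l₀ | no l₁ | no l₂ = contradiction (nbrWeight-total (λ ()) (λ ()) (λ ()) v)
      (<⇒≱ (s≤s (+-mono-≤ (light l₀) (+-mono-≤ (light l₁) (light l₂)))))
      where
      light : ∀ {n} → ¬ 6 ≤ n → n ≤ 5
      light l = ℕ.≤-pred (≰⇒> l)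

  -- What the vertices of a seen copy see

  -- Writing the length as a sum of ones lets `sum-unique-≤` bound it by the number of copies.
  unique-short : ∀ {xs : List Copy} → Unique xs → ¬ 7 ≤ List.sum (map (const 1) xs)
  unique-short xs! 7≤ = <⇒≱ (s≤s (sum-unique-≤ (const 1) xs!)) 7≤

  mono≢ : ∀ {c k X Y} → c ≢ k → Mono c X → Mono k Y → X ≢ Y
  mono≢ c≢k mX mY refl = c≢k (mono-unique mX mY)

  sees-pair-mono : ∀ {v i c D D′} → Sees v i D D′ → Mono c D → Mono c D′
  sees-pair-mono s mD with _ , _ , mD₁ , mD′ ← sees-mono s = subst (λ c → Mono c _) (mono-unique mD₁ mD) mD′

  own-colour≢ : ∀ {v i c D D′} → Sees v i D D′ → Mono c (proj₁ v) → c ≢ i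
  own-colour≢ {v = _ , x} s m c≡i = own s (trans (m x) c≡i)

  class≢ : ∀ {v i c D D′} → Sees v i D D′ → Mono c D → c ≢ i
  class≢ s mD refl = mono⇒¬edge (D∌v s) mD (0F , onto s 0F , onto s 1F)

  orient : ∀ {v i D D′ Y u} → Sees v i D D′ → proj₁ v ≢ Y → col v (Y , u) ≡ i → ∃[ X ] Sees v i Y X
  orient s v∉Y e with only s v∉Y e
  ... | inj₁ refl = _ , s
  ... | inj₂ refl = _ , sees-swap s

  realign : ∀ {v i D E Y u} → Sees v i D E → proj₁ v ≢ Y → col v (Y , u) ≡ i → Y ≢ D → Sees v i D Y
  realign s v∉Y e Y≢D with only s v∉Y e
  ... | inj₁ Y≡D  = contradiction Y≡D Y≢D
  ... | inj₂ refl = s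

  abstract
    -- Let `(D , u)` see its pair in colour j. If j is i, its edge to v puts the copy of v into that
    -- pair. If not, its edges to D′ avoid i because of v, and two consecutive ones cannot both be
    -- c; so one of them has colour j, which puts D′ into the pair.
    response : ∀ {v i c D D′} → Sees v i D D′ → Mono c D → ∀ u →
               ∃[ X ] proj₁ v ≢ X × D ≢ X × D′ ≢ X ×
               (Sees (D , u) i (proj₁ v) X ⊎ ∃[ k ] Sees (D , u) k D′ X)
    response {v} {i} {c} {D} {D′} s mD u with j , _ , _ , t ← sees (D , u) with j ≟ i
    ... | yes refl with X , r ← orient t (≢-sym (D∌v s)) (flip (onto s u)) =
      X , D≢D′ r , D′∌v r ,
      (λ { refl → no-triangle (across (D∌v s)) (across (D′∌v s)) (across (D≢D′ s)) (onto s u) (onto′ s 0F) (onto′ r 0F) }) ,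
      inj₁ r
    ... | no j≢i = case orient t (D≢D′ s) (proj₂ back) of λ where
        (X , r) → X , (λ { refl → j≢i (trans (sym (onto′ r _)) (flip (onto s u))) }) ,
                  D′∌v r , D≢D′ r , inj₂ (j , r)
      where
      ≡j : ∀ y → col (D , u) (D′ , y) ≢ c → col (D , u) (D′ , y) ≡ j
      ≡j y ≢c = third-unique (≢-sym (class≢ s mD)) (≢-sym j≢i) (own-colour≢ t mD)
        (no-triangle (across (D∌v s)) (across (D′∌v s)) (across (D≢D′ s)) (onto s u) (onto′ s y)) ≢c
      back : ∃[ y ] col (D , u) (D′ , y) ≡ j
      back with col (D , u) (D′ , 0F) ≟ c | col (D , u) (D′ , 1F) ≟ c
      ... | no ≢c | _ = 0F , ≡j 0F ≢c
      ... | yes _ | no ≢c = 1F , ≡j 1F ≢c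
      ... | yes e | yes e′ = contradiction (0F , e , e′) (mono⇒¬edge (D≢D′ s) (sees-pair-mono s mD))

    -- Otherwise only c and k occur between X and Y. By parity a vertex of X sends k to two
    -- consecutive vertices of Y, which is excluded, or sends c to both; then its successor in X
    -- must send k to both, which is excluded as well.
    link : ∀ {c k t X Y} → c ≢ k → c ≢ t → k ≢ t → Mono c X → Mono k Y →
           ∃[ x ] ∃[ y ] col (X , x) (Y , y) ≡ t
    link {c} {k} {t} {X} {Y} c≢k c≢t k≢t mX mY
      with any? (λ x → any? λ y → col (X , x) (Y , y) ≟ t)
    ... | yes found = found
    ... | no none = contradiction (odd-cycle (λ y → col (X , 0F) (Y , y) ≟ k)) λ where
        (y , inj₁ (e , e′)) → mono⇒¬edge X≢Y mY (y , e , e′)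
        (y , inj₂ (≢k , ≢k′)) → mono⇒¬edge X≢Y mY
          (y , then-k y ≢k , then-k (next y) ≢k′)
      where
      X≢Y : X ≢ Y
      X≢Y = mono≢ c≢k mX mY
      ≢t : ∀ x y → col (X , x) (Y , y) ≢ t
      ≢t x y e = none (x , y , e)
      then-k : ∀ y → col (X , 0F) (Y , y) ≢ k → col (X , 1F) (Y , y) ≡ k
      then-k y ≢k = third-unique (≢-sym c≢t) (≢-sym k≢t) c≢k (≢t 1F y) λ e →
        mono⇒¬edge (≢-sym X≢Y) mX (0F , flip (third-unique (≢-sym k≢t) (≢-sym c≢t) (≢-sym c≢k) (≢t 0F y) ≢k) , flip e)

  -- No pair seen within its own colour class

  NoneWithin : Set
  NoneWithin = ∀ {c x i D D′} → Mono c (proj₁ x) → Sees x i D D′ → ¬ Mono c D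

  module _ (none-within : NoneWithin) where

    -- In `response` the second alternative is a pair within one colour class.
    abstract
      respond : ∀ {c k t X x Y Y′} → Mono c X → Mono k Y → Sees (X , x) t Y Y′ →
                ∀ y → ∃[ Z ] Sees (Y , y) t X Z
      respond mX mY s y with response s mY y
      ... | Z , _ , _ , _ , inj₁ r = Z , r
      ... | _ , _ , _ , _ , inj₂ (_ , r) = contradiction (sees-pair-mono s mY) (none-within mY r)

      -- Responding twice returns to X: every vertex of X sees Y in colour t, and likewise Y′.
      uniform : ∀ {c k t X x Y Y′} → Mono c X → Mono k Y → Sees (X , x) t Y Y′ →
                ∀ x′ → Sees (X , x′) t Y Y′
      uniform mX mY s x′
        with _ , r ← respond mX mY s 0F | _ , r′ ← respond mX (sees-pair-mono s mY) (sees-swap s) 0F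
        with _ , q ← respond mY mX r x′ | _ , q′ ← respond (sees-pair-mono s mY) mX r′ x′
        = realign q (D∌v q′) (onto q′ 0F) (≢-sym (D≢D′ s))

    -- X and Z are monochromatic of colour c, Y and Y′ of colour k, and the edges of
    -- colour t at each of these four copies are exactly the sides of X Y Z Y′.
    record Square (c k t : Colour) (X Z Y Y′ : Copy) : Set where
      field
        mX  : Mono c X
        mY  : Mono k Y
        sX  : ∀ x → Sees (X , x) t Y Y′
        sZ  : ∀ x → Sees (Z , x) t Y Y′
        sY  : ∀ x → Sees (Y , x) t X Z
        sY′ : ∀ x → Sees (Y′ , x) t X Z

    transpose : ∀ {c k t X Z Y Y′} → Square c k t X Z Y Y′ → Square k c t Y Y′ X Z
    transpose q = record { mX = mY ; mY = mX ; sX = sY ; sZ = sY′ ; sY = sX ; sY′ = sZ }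
      where open Square q

    -- By `link`, Y has a t-edge to every c-monochromatic copy, so A and B are X and Z. For s = t,
    -- the t-edges from X lead only to Y and Y′, hence not to f. For other s, the edges from X to Z
    -- avoid t, and avoid s because of f, so they have the inner colour c of Z.
    unseen : ∀ {c k t X Z Y Y′ f s A B} → c ≢ k → c ≢ t → k ≢ t → Square c k t X Z Y Y′ →
             proj₁ f ≢ Y → proj₁ f ≢ Y′ → Sees f s A B → ¬ Mono c A
    unseen {c} {k} {t} {X} {Z} {Y} {Y′} {f} {s} {A} {B} c≢k c≢t k≢t q f∉Y f∉Y′ r mA =
      [ (λ { refl → [ (λ B≡X → D≢D′ r (sym B≡X)) , (λ { refl → blind r }) ]′ (corner (sees-pair-mono r mA)) })
      , (λ { refl → [ (λ { refl → blind (sees-swap r) }) , (λ B≡Z → D≢D′ r (sym B≡Z)) ]′ (corner (sees-pair-mono r mA)) })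
      ]′ (corner mA)
      where
      open Square q
      corner : ∀ {A} → Mono c A → A ≡ X ⊎ A ≡ Z
      corner mA with a , y , e ← link c≢k c≢t k≢t mA mY = only (sY y) (mono≢ (≢-sym c≢k) mY mA) (flip e)

      X≢Z : X ≢ Z
      X≢Z = D≢D′ (sY 0F)

      blind : ¬ Sees f s X Z
      blind r with s ≟ t
      ... | yes refl = [ f∉Y , f∉Y′ ]′ (only (sX 0F) (≢-sym (D∌v r)) (flip (onto r 0F)))
      ... | no s≢t = mono⇒¬edge X≢Z (sees-pair-mono r mX) (0F , is-c 0F , is-c 1F)
        where
        is-c : ∀ z → col (X , 0F) (Z , z) ≡ c
        is-c z = third-unique s≢t (≢-sym (class≢ r mX))
          (≢-sym c≢t)
          (no-triangle (across (D∌v r)) (across (D′∌v r)) (across X≢Z) (onto r 0F) (onto′ r z))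
          (λ e → [ (λ Z≡Y → D′∌v (sY 0F) (sym Z≡Y)) , (λ Z≡Y′ → D′∌v (sY′ 0F) (sym Z≡Y′)) ]′ (only (sX 0F) X≢Z e))

    -- Y sees X and some Z, and Y′ sees X and some Z′. A t-edge from `link` between Z and Y′ forces
    -- Z′ to be Z, which closes the 4-cycle.
    square-of : ∀ {c k t X x Y Y′} → c ≢ k → c ≢ t → k ≢ t → Mono c X → Mono k Y →
                Sees (X , x) t Y Y′ → ∃[ Z ] Square c k t X Z Y Y′
    square-of {c} {k} {t} {X} {x} {Y} {Y′} c≢k c≢t k≢t mX mY s = close (respond mX mY s 0F) (respond mX mY′ (sees-swap s) 0F)
      where
      mY′ : Mono k Y′
      mY′ = sees-pair-mono s mY

      close : (∃[ Z ] Sees (Y , 0F) t X Z) → (∃[ Z′ ] Sees (Y′ , 0F) t X Z′) → ∃[ Z ] Square c k t X Z Y Y′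
      close (Z , r) (Z′ , r′) = Z , record
        { mX = mX ; mY = mY ; sX = uniform mX mY s ; sZ = sZ ; sY = uniform mY mX r ; sY′ = sY′ }
        where
        mZ : Mono c Z
        mZ = sees-pair-mono r mX

        sY′ : ∀ y → Sees (Y′ , y) t X Z
        sY′ y = case link c≢k c≢t k≢t mZ mY′ of λ where
          (_ , y₁ , e) → uniform mY′ mX
            (realign (uniform mY′ mX r′ y₁) (mono≢ (≢-sym c≢k) mY′ mZ) (flip e) (≢-sym (D≢D′ r))) y

        sZ : ∀ z → Sees (Z , z) t Y Y′
        sZ z = realign (proj₂ (respond mY mZ (sees-swap r) z)) (D∌v q′) (onto q′ 0F) (≢-sym (D≢D′ s))
          where q′ = proj₂ (respond mY′ mZ (sees-swap (sY′ 0F)) z)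

    square : ∃[ c ] ∃[ k ] ∃[ t ] c ≢ k × c ≢ t × k ≢ t × ∃[ X ] ∃[ Z ] ∃[ Y ] ∃[ Y′ ] Square c k t X Z Y Y′
    square = case sees (0F , 0F) of λ where
      (_ , X , _ , s₀) → case sees-mono s₀ of λ where
        (c , _ , mX , _) → case sees (X , 0F) of λ where
          (t , Y , Y′ , s) → case sees-mono s of λ where
            (k , k≢t , mY , _) →
              let c≢k = λ { refl → none-within mX s mY }
                  Z , q = square-of c≢k (own-colour≢ s mX) k≢t mX mY s
              in c , k , t , c≢k , own-colour≢ s mX , k≢t , X , Z , Y , Y′ , q

    -- A vertex of a copy F outside the square sees a pair of some inner colour p. The cases p = c
    -- and p = k fall to `unseen` and its transpose.
    none-within⇒⊥ : ⊥
    none-within⇒⊥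
      with c , k , t , c≢k , c≢t , k≢t , X , Z , Y , Y′ , q ← square
      with F , F∉ ← ∉-short (X ∷ Z ∷ Y ∷ Y′ ∷ []) (s≤s (s≤s (s≤s (s≤s (s≤s z≤n)))))
      with i , A , B , s ← sees (F , 0F)
      with p , _ , mA , mB ← sees-mono s
      = p≢c λ where refl → unseen c≢k c≢t k≢t q F≢Y F≢Y′ s mA
      where
      open Square q
      F≢X : F ≢ X
      F≢X e = F∉ (here e)
      F≢Z : F ≢ Z
      F≢Z e = F∉ (there (here e))
      F≢Y : F ≢ Y
      F≢Y e = F∉ (there (there (here e)))
      F≢Y′ : F ≢ Y′
      F≢Y′ e = F∉ (there (there (there (here e))))
      mZ : Mono c Z
      mZ = sees-pair-mono (sY 0F) mX
      mY′ : Mono k Y′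
      mY′ = sees-pair-mono (sX 0F) mY
      p≢c : ¬ p ≢ c
      p≢c p≢c with p ≟ k
      ... | yes refl = unseen (≢-sym c≢k) k≢t c≢t (transpose q) F≢X F≢Z s mA
      -- For the remaining colour, the seen pair, F and the square are seven distinct copies.
      ... | no p≢k = unique-short
        ( (D≢D′ s ∷ ≢-sym (D∌v s) ∷ mono≢ p≢c mA mX ∷ mono≢ p≢c mA mZ ∷ mono≢ p≢k mA mY ∷ mono≢ p≢k mA mY′ ∷ [])
        ∷ (≢-sym (D′∌v s) ∷ mono≢ p≢c mB mX ∷ mono≢ p≢c mB mZ ∷ mono≢ p≢k mB mY ∷ mono≢ p≢k mB mY′ ∷ [])
        ∷ (F≢X ∷ F≢Z ∷ F≢Y ∷ F≢Y′ ∷ [])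
        ∷ (D≢D′ (sY 0F) ∷ D∌v (sX 0F) ∷ D′∌v (sX 0F) ∷ [])
        ∷ (D∌v (sZ 0F) ∷ D′∌v (sZ 0F) ∷ [])
        ∷ (D≢D′ (sX 0F) ∷ [])
        ∷ [] ∷ []) ≤-refl

  -- At least four copies of one colour

  nbrWeight-none : ∀ {i v Y} → (∀ {u} → proj₁ v ≢ Y → col v (Y , u) ≢ i) →
           (proj₁ v ≡ Y → col v (proj₁ v , next (proj₂ v)) ≢ i) → nbrWeight i v Y ≡ 0
  nbrWeight-none {i} {v@(X , x)} {Y} apart own with X ≟ Y
  ... | yes X≡Y = cong (if_then 1 else 0) (dec-false (col v (X , next x) ≟ i) (own X≡Y))
  ... | no X≢Y  = weight-none {f = line v Y} λ (_ , e) → apart X≢Y e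

  nbrWeight-mono≤1 : ∀ {c v Y} → Mono c Y → nbrWeight c v Y ≤ 1
  nbrWeight-mono≤1 {c} {v@(X , x)} {Y} m with X ≟ Y
  ... | no X≢Y = weight≤1 (λ f → mono⇒¬edge X≢Y m (0F , f 0F , f 1F)) (mono⇒¬edge X≢Y m)
  ... | yes _ with col v (X , next x) ≟ c
  ...   | yes _ = ≤-refl
  ...   | no _  = z≤n

  nbrWeight-full≡0 : ∀ {i c v D} → i ≢ c → proj₁ v ≢ D → Full i (line v D) → nbrWeight c v D ≡ 0
  nbrWeight-full≡0 i≢c v∉D f = nbrWeight-none (λ _ e → i≢c (trans (sym (f _)) e)) (λ v∈D → contradiction v∈D v∉D)

  pair : Copy → Copy → Vector ℕ 6
  pair D D′ Y = 𝟙 (Y ≟ D) + 𝟙 (Y ≟ D′)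

  sum-pair : ∀ D D′ → sum (pair D D′) ≡ 2
  sum-pair = toWitness {a? = all? λ D → all? λ D′ → sum (pair D D′) ℕ.≟ 2} _

  nbrWeight-sees : ∀ {v i D D′} → Sees v i D D′ → sum (nbrWeight i v) ≤ 6
  nbrWeight-sees {v} {i} {D} {D′} s = begin
    sum (nbrWeight i v)           ≤⟨ sum-mono bound ⟩
    ∑[ Y < 6 ] (pair D D′ Y * 3)  ≡⟨ *-distribʳ-sum 3 (pair D D′) ⟨
    sum (pair D D′) * 3           ≡⟨ cong (_* 3) (sum-pair D D′) ⟩
    6                             ∎
    where
    open ℕ.≤-Reasoning
    bound : ∀ Y → nbrWeight i v Y ≤ pair D D′ Y * 3
    bound Y with Y ≟ D | Y ≟ D′
    ... | yes _  | yes _   = ≤-trans (nbrWeight≤3 i v Y) (s≤s (s≤s (s≤s z≤n)))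
    ... | yes _  | no _    = nbrWeight≤3 i v Y
    ... | no _   | yes _   = nbrWeight≤3 i v Y
    ... | no Y≢D | no Y≢D′ = ≤-reflexive (nbrWeight-none
      (λ v∉Y e → [ Y≢D , Y≢D′ ]′ (only s v∉Y e)) (λ _ → own s))

  abstract
    -- Let k be the third colour. If x also sees a pair in k, a copy outside both pairs and the copy
    -- of x receives neither i nor k from x. Otherwise colours i and k weigh at most 6 + 5 of the
    -- total 16.
    own-weight : ∀ {c x i D D′} → Mono c (proj₁ x) → Sees x i D D′ →
                 (∃[ Y ] proj₁ x ≢ Y × D ≢ Y × D′ ≢ Y × Full c (line x Y)) ⊎ 5 ≤ sum (nbrWeight c x)
    own-weight {c} {x} {i} {D} {D′} m s
      with c≢i ← own-colour≢ s m
      with k , c≢k , i≢k ← third c≢i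
      with 6 ≤? sum (nbrWeight k x)
    ... | no light = inj₂ (ℕ.+-cancelʳ-≤ 11 5 _ (≤-trans (nbrWeight-total c≢i c≢k i≢k x)
            (+-monoʳ-≤ _ (+-mono-≤ (nbrWeight-sees s) (ℕ.≤-pred (≰⇒> light))))))
    ... | yes heavy
      with E , E′ , r ← heavy⇒sees heavy
      with Y , Y∉ ← ∉-short (proj₁ x ∷ D ∷ D′ ∷ E ∷ E′ ∷ []) ≤-refl
      = inj₁ (Y , x∉Y , D≢Y , D′≢Y , λ u → third-unique i≢k (≢-sym c≢i) (≢-sym c≢k)
          (λ e → [ D≢Y ∘ sym , D′≢Y ∘ sym ]′ (only s x∉Y e))
          (λ e → [ (λ Y≡E → Y∉ (there (there (there (here Y≡E)))))
                 , (λ Y≡E′ → Y∉ (there (there (there (there (here Y≡E′)))))) ]′ (only r x∉Y e)))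
      where
      x∉Y : proj₁ x ≢ Y
      x∉Y e = Y∉ (here (sym e))
      D≢Y : D ≢ Y
      D≢Y e = Y∉ (there (here (sym e)))
      D′≢Y : D′ ≢ Y
      D′≢Y e = Y∉ (there (there (here (sym e))))

  module _ (c : Colour) where

    isMono : Vector ℕ 6
    isMono Y = 𝟙 (mono? c Y)

    isPoly : Vector ℕ 6
    isPoly Y = if does (mono? c Y) then 0 else 1

    m : ℕ
    m = sum isMono

    mono+poly : m + sum isPoly ≡ 6
    mono+poly = begin
      m + sum isPoly                    ≡⟨ ∑-distrib-+ isMono isPoly ⟨
      ∑[ Y < 6 ] (isMono Y + isPoly Y)  ≡⟨ sum-cong-≗ one ⟩
      6                                 ∎
      where
      open ≡-Reasoning
      one : ∀ Y → isMono Y + isPoly Y ≡ 1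
      one Y with does (mono? c Y)
      ... | true  = refl
      ... | false = refl

    poly-≤ : ∀ {xs} → All (¬_ ∘ Mono c) xs → Unique xs → length xs ≤ sum isPoly
    poly-≤ ¬ms xs! = subst (_≤ sum isPoly) (weigh ¬ms) (sum-unique-≤ isPoly xs!)
      where
      weigh : ∀ {xs} → All (¬_ ∘ Mono c) xs → List.sum (map isPoly xs) ≡ length xs
      weigh []         = refl
      weigh {Y ∷ _} (¬m ∷ ¬ms) = cong₂ _+_ (cong (if_then 0 else 1) (dec-false (mono? c Y) ¬m)) (weigh ¬ms)

    mono-≤ : ∀ {xs} → All (Mono c) xs → Unique xs → length xs ≤ m
    mono-≤ ms xs! = subst (_≤ m) (weigh ms) (sum-unique-≤ isMono xs!)
      where
      weigh : ∀ {xs} → All (Mono c) xs → List.sum (map isMono xs) ≡ length xs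
      weigh []         = refl
      weigh {Y ∷ _} (mY ∷ ms) = cong₂ _+_ (cong (if_then 1 else 0) (dec-true (mono? c Y) mY)) (weigh ms)

    module _ (4≤m : 4 ≤ m) where

      poly≤2 : sum isPoly ≤ 2
      poly≤2 = ℕ.+-cancelˡ-≤ 4 _ 2 (≤-trans (+-monoˡ-≤ _ 4≤m) (≤-reflexive mono+poly))

      no-three-poly : ∀ {A B C} → ¬ Mono c A → ¬ Mono c B → ¬ Mono c C → A ≢ B → A ≢ C → ¬ B ≢ C
      no-three-poly ¬A ¬B ¬C A≢B A≢C B≢C = <⇒≱ (s≤s poly≤2)
        (poly-≤ (¬A ∷ ¬B ∷ ¬C ∷ []) ((A≢B ∷ A≢C ∷ []) ∷ (B≢C ∷ []) ∷ [] ∷ []))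

      -- Suppose D, and hence D′, is not c-monochromatic. These are then the only such copies, so
      -- the copy of v is c-monochromatic and `own-weight` applies. A full c-coloured copy would be
      -- a third exception; otherwise weight 5 in colour c, with nothing from D and D′ and at most 1
      -- from every other copy, needs five further copies.
      sees-c : ∀ v → ∃[ i ] ∃[ D ] ∃[ D′ ] Sees v i D D′ × Mono c D × Mono c D′
      sees-c v@(X , x) = case sees v of λ where
          (i , D , D′ , s) → i , D , D′ , s , mono-D s , mono-D (sees-swap s)
        where
        mono-D : ∀ {i D D′} → Sees v i D D′ → Mono c D
        mono-D {i} {D} {D′} s = decidable-stable (mono? c D) λ ¬D →
          let ¬D′ : ¬ Mono c D′
              ¬D′ mD′ = ¬D (sees-pair-mono (sees-swap s) mD′)
              mX : Mono c X
              mX = decidable-stable (mono? c X) λ ¬X → no-three-poly ¬X ¬D ¬D′ (D∌v s) (D′∌v s) (D≢D′ s)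
          in [ (λ (Y , X≢Y , D≢Y , D′≢Y , f) → no-three-poly ¬D ¬D′
                 (λ mY → mono⇒¬edge X≢Y mY (0F , f 0F , f 1F)) (D≢D′ s) D≢Y D′≢Y)
             , (λ 5≤ → <⇒≱ (s≤s (≤-reflexive mono+poly))
                 (+-mono-≤ (≤-trans 5≤ (sum-mono (nbrWeight≤isMono mX s ¬D ¬D′)))
                           (poly-≤ (¬D ∷ ¬D′ ∷ []) ((D≢D′ s ∷ []) ∷ [] ∷ []))))
             ]′ (own-weight mX s)
          where
          nbrWeight≤isMono : Mono c X → Sees v i D D′ → ¬ Mono c D → ¬ Mono c D′ → ∀ Y → nbrWeight c v Y ≤ isMono Y
          nbrWeight≤isMono mX s ¬D ¬D′ Y with mono? c Y
          ... | yes mY = nbrWeight-mono≤1 {v = v} mY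
          ... | no ¬Y with Y ≟ D | Y ≟ D′
          ...   | yes refl | _ = ≤-reflexive (nbrWeight-full≡0 (≢-sym (own-colour≢ s mX)) (D∌v s) (onto s))
          ...   | no _ | yes refl = ≤-reflexive (nbrWeight-full≡0 (≢-sym (own-colour≢ s mX)) (D′∌v s) (onto′ s))
          ...   | no Y≢D | no Y≢D′ = contradiction (≢-sym Y≢D′) (no-three-poly ¬D ¬D′ ¬Y (D≢D′ s) (≢-sym Y≢D))

      -- Double counting of the crossing edges

      outward : V → Vector ℕ 6
      outward x Y = if does (mono? c Y) then 0 else count c (line x Y)

      inward : V → Vector ℕ 6
      inward y X = if does (mono? c X) then count c (λ u → col (X , u) y) else 0

      -- A full copy alone gives five outward edges. Otherwise x has weight at least 5 in colour c;
      -- c-monochromatic copies contribute at most 1 each, and the two seen ones nothing, which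
      -- gains 2.
      outward-≥ : ∀ {x} → Mono c (proj₁ x) → 7 ≤ m + sum (outward x)
      outward-≥ {x@(X , _)} mX = case sees-c x of λ where
          (i , D , D′ , s , mD , mD′) → case own-weight mX s of λ where
            (inj₁ (Y , X≢Y , _ , _ , f)) → ≤-trans (s≤s (s≤s (s≤s (s≤s (s≤s (s≤s (s≤s z≤n)))))))
              (+-mono-≤ 4≤m (≤-trans (full-out X≢Y f) (≤-trans (ℕ.m≤m+n _ 0) (sum-unique-≤ (outward x) ([] ∷ [])))))
            (inj₂ 5≤) → begin
              7                                           ≤⟨ +-monoˡ-≤ 2 5≤ ⟩
              sum (nbrWeight c x) + 2                     ≡⟨ cong (sum (nbrWeight c x) +_) (sum-pair D D′) ⟨
              sum (nbrWeight c x) + sum (pair D D′)       ≡⟨ ∑-distrib-+ (nbrWeight c x) (pair D D′) ⟨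
              ∑[ Y < 6 ] (nbrWeight c x Y + pair D D′ Y)  ≤⟨ sum-mono (bound s mD mD′) ⟩
              ∑[ Y < 6 ] (isMono Y + outward x Y)         ≡⟨ ∑-distrib-+ isMono (outward x) ⟩
              m + sum (outward x)                         ∎
        where
        open ℕ.≤-Reasoning
        full-out : ∀ {Y} → X ≢ Y → Full c (line x Y) → 5 ≤ outward x Y
        full-out {Y} X≢Y f with mono? c Y
        ... | yes mY = contradiction (0F , f 0F , f 1F) (mono⇒¬edge X≢Y mY)
        ... | no _   = count-full f

        nbrWeight≤count : ∀ {Y} → X ≢ Y → nbrWeight c x Y ≤ count c (line x Y)
        nbrWeight≤count {Y} X≢Y with X ≟ Y
        ... | yes X≡Y = contradiction X≡Y X≢Y
        ... | no _    = weight≤count c (line x Y)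

        bound : ∀ {i D D′} → Sees x i D D′ → Mono c D → Mono c D′ →
                ∀ Y → nbrWeight c x Y + pair D D′ Y ≤ isMono Y + outward x Y
        bound {i} {D} {D′} s mD mD′ Y with mono? c Y | Y ≟ D | Y ≟ D′
        ... | _      | yes refl | yes refl = contradiction refl (D≢D′ s)
        ... | yes _  | yes refl | no _     = ≤-reflexive (cong (_+ 1) (nbrWeight-full≡0 (≢-sym (own-colour≢ s mX)) (D∌v s) (onto s)))
        ... | yes _  | no _     | yes refl = ≤-reflexive (cong (_+ 1) (nbrWeight-full≡0 (≢-sym (own-colour≢ s mX)) (D′∌v s) (onto′ s)))
        ... | yes mY | no _     | no _     = +-mono-≤ (nbrWeight-mono≤1 {v = x} mY) z≤n
        ... | no ¬Y  | yes refl | no _     = contradiction mD ¬Y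
        ... | no ¬Y  | no _     | yes refl = contradiction mD′ ¬Y
        ... | no ¬Y  | no _     | no _     = ≤-trans (≤-reflexive (+-identityʳ _)) (nbrWeight≤count λ { refl → ¬Y mX })

      -- The two copies that y sees send it no edge of colour c, and each other c-monochromatic copy
      -- at most two. This is the bound 2(m - 2) without subtraction.
      inward-≤ : ∀ {y} → ¬ Mono c (proj₁ y) → sum (inward y) + 4 ≤ m * 2
      inward-≤ {y@(Y , _)} ¬mY = case sees-c y of λ where
          (i , D , D′ , s , mD , mD′) → begin
            sum (inward y) + 4                             ≡⟨ cong (λ n → sum (inward y) + n * 2) (sum-pair D D′) ⟨
            sum (inward y) + sum (pair D D′) * 2           ≡⟨ cong (sum (inward y) +_) (*-distribʳ-sum 2 (pair D D′)) ⟩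
            sum (inward y) + ∑[ X < 6 ] (pair D D′ X * 2)  ≡⟨ ∑-distrib-+ (inward y) (λ X → pair D D′ X * 2) ⟨
            ∑[ X < 6 ] (inward y X + pair D D′ X * 2)      ≤⟨ sum-mono (bound s mD mD′) ⟩
            ∑[ X < 6 ] (isMono X * 2)                      ≡⟨ *-distribʳ-sum 2 isMono ⟨
            m * 2                                          ∎
        where
        open ℕ.≤-Reasoning
        none : ∀ {i D D′} → Sees y i D D′ → Mono c D → ¬ Point c (λ u → col (D , u) y)
        none s mD (u , e) = class≢ s mD (trans (sym (flip e)) (onto s u))

        bound : ∀ {i D D′} → Sees y i D D′ → Mono c D → Mono c D′ →
                ∀ X → inward y X + pair D D′ X * 2 ≤ isMono X * 2
        bound {i} {D} {D′} s mD mD′ X with mono? c X | X ≟ D | X ≟ D′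
        ... | _      | yes refl | yes refl = contradiction refl (D≢D′ s)
        ... | yes _  | yes refl | no _     = +-monoˡ-≤ 2 (count-none (none s mD))
        ... | yes _  | no _     | yes refl = +-monoˡ-≤ 2 (count-none (none (sees-swap s) mD′))
        ... | yes mX | no _     | no _     = ≤-trans (≤-reflexive (+-identityʳ _))
          (count≤2 c (λ u → col (X , u) y) λ (u , e , e′) →
            mono⇒¬edge {v = y} (λ { refl → ¬mY mX }) mX (u , flip e , flip e′))
        ... | no ¬X  | yes refl | no _     = contradiction mD ¬X
        ... | no ¬X  | no _     | yes refl = contradiction mD′ ¬X
        ... | no ¬X  | no _     | no _     = z≤n

      -- Edges of colour c from c-monochromatic copies to the others.
      crossing : V → V → ℕ
      crossing x y = if does (mono? c (proj₁ x)) then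
        (if does (mono? c (proj₁ y)) then 0 else 𝟙 (col x y ≟ c)) else 0

      total : ℕ
      total = ∑[ X < 6 ] ∑[ x < 5 ] ∑[ Y < 6 ] ∑[ y < 5 ] crossing (X , x) (Y , y)

      total-by-columns : total ≡ ∑[ Y < 6 ] ∑[ y < 5 ] ∑[ X < 6 ] ∑[ x < 5 ] crossing (X , x) (Y , y)
      total-by-columns = begin
        ∑[ X < 6 ] ∑[ x < 5 ] ∑[ Y < 6 ] ∑[ y < 5 ] e X x Y y
          ≡⟨ sum-cong-≗ (λ X → ∑-comm (λ x Y → ∑[ y < 5 ] e X x Y y)) ⟩
        ∑[ X < 6 ] ∑[ Y < 6 ] ∑[ x < 5 ] ∑[ y < 5 ] e X x Y y
          ≡⟨ ∑-comm (λ X Y → ∑[ x < 5 ] ∑[ y < 5 ] e X x Y y) ⟩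
        ∑[ Y < 6 ] ∑[ X < 6 ] ∑[ x < 5 ] ∑[ y < 5 ] e X x Y y
          ≡⟨ sum-cong-≗ (λ Y → sum-cong-≗ λ X → ∑-comm (λ x y → e X x Y y)) ⟩
        ∑[ Y < 6 ] ∑[ X < 6 ] ∑[ y < 5 ] ∑[ x < 5 ] e X x Y y
          ≡⟨ sum-cong-≗ (λ Y → ∑-comm (λ X y → ∑[ x < 5 ] e X x Y y)) ⟩
        ∑[ Y < 6 ] ∑[ y < 5 ] ∑[ X < 6 ] ∑[ x < 5 ] e X x Y y
          ∎
        where
        open ≡-Reasoning
        e : Copy → Fin 5 → Copy → Fin 5 → ℕ
        e X x Y y = crossing (X , x) (Y , y)

      -- The parameter r stands for 7 - m, as s does for 2m - 4 in `total-≤`; the factor 5 counts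
      -- the vertices of a copy.
      total-≥ : ∀ r → r + m ≤ 7 → m * (5 * r) ≤ total
      total-≥ r r+m≤7 = begin
        m * (5 * r)                      ≡⟨ *-distribʳ-sum (5 * r) isMono ⟩
        ∑[ X < 6 ] (isMono X * (5 * r))  ≤⟨ sum-mono rows ⟩
        total                            ∎
        where
        open ℕ.≤-Reasoning
        rows : ∀ X → isMono X * (5 * r) ≤ ∑[ x < 5 ] ∑[ Y < 6 ] ∑[ y < 5 ] crossing (X , x) (Y , y)
        rows X with mono? c X
        ... | no _ = z≤n
        ... | yes mX = ≤-trans (≤-reflexive (+-identityʳ (5 * r))) (sum-mono {n = 5} {f = const r} row-≥)
          where
          row-≥ : ∀ x → r ≤ ∑[ Y < 6 ] ∑[ y < 5 ] (if does (mono? c Y) then 0 else 𝟙 (col (X , x) (Y , y) ≟ c))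
          row-≥ x = ≤-trans
            (ℕ.+-cancelʳ-≤ m r _ (≤-trans r+m≤7 (≤-trans (outward-≥ {X , x} mX) (≤-reflexive (ℕ.+-comm m _)))))
            (sum-mono outward≤)
            where
            outward≤ : ∀ Y → outward (X , x) Y ≤ ∑[ y < 5 ] (if does (mono? c Y) then 0 else 𝟙 (col (X , x) (Y , y) ≟ c))
            outward≤ Y with does (mono? c Y)
            ... | true  = z≤n
            ... | false = ≤-refl

      total-≤ : ∀ s → m * 2 ≤ s + 4 → total ≤ sum isPoly * (5 * s)
      total-≤ s 2m≤ = begin
        total                                                                 ≡⟨ total-by-columns ⟩
        ∑[ Y < 6 ] ∑[ y < 5 ] ∑[ X < 6 ] ∑[ x < 5 ] crossing (X , x) (Y , y)  ≤⟨ sum-mono columns ⟩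
        ∑[ Y < 6 ] (isPoly Y * (5 * s))                                       ≡⟨ *-distribʳ-sum (5 * s) isPoly ⟨
        sum isPoly * (5 * s)                                                  ∎
        where
        open ℕ.≤-Reasoning
        columns : ∀ Y → ∑[ y < 5 ] ∑[ X < 6 ] ∑[ x < 5 ] crossing (X , x) (Y , y) ≤ isPoly Y * (5 * s)
        columns Y with mono? c Y
        ... | yes _ = sum-mono {n = 5} {g = const 0} λ _ → sum-mono {n = 6} {g = const 0} λ X →
          sum-mono {n = 5} {g = const 0} λ _ → vanish X
          where
          vanish : ∀ X → (if does (mono? c X) then 0 else 0) ≤ 0
          vanish X with does (mono? c X)
          ... | true  = z≤n
          ... | false = z≤n
        ... | no ¬mY = ≤-trans (sum-mono {n = 5} {g = const s} column-≤) (≤-reflexive (sym (+-identityʳ (5 * s))))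
          where
          column-≤ : ∀ y → ∑[ X < 6 ] ∑[ x < 5 ] (if does (mono? c X) then 𝟙 (col (X , x) (Y , y) ≟ c) else 0) ≤ s
          column-≤ y = ≤-trans (sum-mono ≤inward)
            (ℕ.+-cancelʳ-≤ 4 _ s (≤-trans (inward-≤ {Y , y} ¬mY) 2m≤))
            where
            ≤inward : ∀ X → ∑[ x < 5 ] (if does (mono? c X) then 𝟙 (col (X , x) (Y , y) ≟ c) else 0) ≤ inward (Y , y) X
            ≤inward X with does (mono? c X)
            ... | true  = ≤-refl
            ... | false = z≤n

      -- With m copies of colour c, a vertex of one of them has at least 7 − m crossing
      -- edges and a vertex outside has at most 2m − 4, so m(7 − m) ≤ (6 − m)(2m − 4).
      four-mono⇒⊥ : ⊥
      four-mono⇒⊥ = clash m (sum isPoly) 4≤m mono+poly total-≥ total-≤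
        where
        clash : ∀ m p {t} → 4 ≤ m → m + p ≡ 6 → (∀ r → r + m ≤ 7 → m * (5 * r) ≤ t) →
                (∀ s → m * 2 ≤ s + 4 → t ≤ p * (5 * s)) → ⊥
        -- The lower and upper counts are 60 and 40, then 50 and 30, then 30 and 0.
        clash 4 2 _ refl lower upper = <⇒≱ (toWitness {a? = 41 ≤? 60} _) (≤-trans (lower 3 ≤-refl) (upper 4 ≤-refl))
        clash 5 1 _ refl lower upper = <⇒≱ (toWitness {a? = 31 ≤? 50} _) (≤-trans (lower 2 ≤-refl) (upper 6 ≤-refl))
        clash 6 0 _ refl lower upper = <⇒≱ (toWitness {a? = 1 ≤? 30} _) (≤-trans (lower 1 ≤-refl) (upper 8 ≤-refl))
        clash 1 _ (s≤s ())
        clash 2 _ (s≤s (s≤s ()))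
        clash 3 _ (s≤s (s≤s (s≤s ())))

  -- A violation of `NoneWithin` gives three c-monochromatic copies; `response` adds a fourth, Z,
  -- seen together with the copy of x or with D′.
  no-triangle⇒⊥ : ⊥
  no-triangle⇒⊥ = none-within⇒⊥ λ {c} {x} {i} {D} {D′} mX s mD → case response s mD 0F of λ where
    (Z , x∉Z , D≢Z , D′≢Z , r) → four-mono⇒⊥ c (mono-≤ c
      (mX ∷ mD ∷ sees-pair-mono s mD ∷
        [ (λ r → sees-pair-mono r mX) , (λ (_ , r) → sees-pair-mono r (sees-pair-mono s mD)) ]′ r ∷ [])
      ((D∌v s ∷ D′∌v s ∷ x∉Z ∷ []) ∷ (D≢D′ s ∷ D≢Z ∷ []) ∷ (D′≢Z ∷ []) ∷ [] ∷ []))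

-- Transfer to edge colourings

H : Graph
H = C₅ +ᶻ C₅ +ᶻ C₅ +ᶻ C₅ +ᶻ C₅ +ᶻ C₅

vertexOf : V → Vertex H
vertexOf (0F , u) = inj₁ (inj₁ (inj₁ (inj₁ (inj₁ u))))
vertexOf (1F , u) = inj₁ (inj₁ (inj₁ (inj₁ (inj₂ u))))
vertexOf (2F , u) = inj₁ (inj₁ (inj₁ (inj₂ u)))
vertexOf (3F , u) = inj₁ (inj₁ (inj₂ u))
vertexOf (4F , u) = inj₁ (inj₂ u)
vertexOf (5F , u) = inj₂ u

vertexOf-adj : ∀ {x y} → x ~ y → Adj H (vertexOf x) (vertexOf y)
vertexOf-adj (across {X} {Y} {u} {v} X≢Y) = table X Y X≢Y u v
  where
  table : ∀ X Y → X ≢ Y → ∀ u v → Adj H (vertexOf (X , u)) (vertexOf (Y , v))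
  table = toWitness {a? = all? λ X → all? λ Y → ¬? (X ≟ Y) →-dec
    all? λ u → all? λ v → adj? H (vertexOf (X , u)) (vertexOf (Y , v))} _
vertexOf-adj (within {0F} a) = a
vertexOf-adj (within {1F} a) = a
vertexOf-adj (within {2F} a) = a
vertexOf-adj (within {3F} a) = a
vertexOf-adj (within {4F} a) = a
vertexOf-adj (within {5F} a) = a

_~?_ : ∀ x y → Dec (x ~ y)
(X , u) ~? (Y , v) with X ≟ Y
... | no X≢Y = yes (across X≢Y)
... | yes refl = map′ within (λ { (across X≢X) → contradiction refl X≢X ; (within a) → a }) (adj? C₅ u v)

module _ (χ : EdgeColouring H 3) where
  open EdgeColouring χ

  -- The colour 0F of non-edges is never looked at.
  col : V → V → Colour
  col x y with adj? H (vertexOf x) (vertexOf y)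
  ... | yes p = colour (vertexOf x) (vertexOf y) p
  ... | no _  = 0F

  col-colour : ∀ {x y} (p : Adj H (vertexOf x) (vertexOf y)) → col x y ≡ colour (vertexOf x) (vertexOf y) p
  col-colour {x} {y} p with adj? H (vertexOf x) (vertexOf y)
  ... | yes q = trans (undirected _ _ q q′) (sym (undirected _ _ p q′))
    where q′ = Graph.sym H {vertexOf x} {vertexOf y} q
  ... | no ¬p = contradiction p ¬p

  col-sym : ∀ x y → col x y ≡ col y x
  col-sym x y with adj? H (vertexOf x) (vertexOf y) | adj? H (vertexOf y) (vertexOf x)
  ... | yes p | yes q = undirected _ _ p q
  ... | yes p | no ¬q = contradiction (Graph.sym H {vertexOf x} {vertexOf y} p) ¬q
  ... | no ¬p | yes q = contradiction (Graph.sym H {vertexOf y} {vertexOf x} q) ¬p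
  ... | no _  | no _  = refl

  Triangle : Colour → V → V → V → Set
  Triangle c x y z = x ~ y × x ~ z × y ~ z × col x y ≡ c × col x z ≡ c × col y z ≡ c

  triangle? : ∀ c x y z → Dec (Triangle c x y z)
  triangle? c x y z = (x ~? y) ×-dec (x ~? z) ×-dec (y ~? z) ×-dec
    (col x y ≟ c) ×-dec (col x z ≟ c) ×-dec (col y z ≟ c)

  any-vertex? : ∀ {P : V → Set} → (∀ x → Dec (P x)) → Dec (∃[ x ] P x)
  any-vertex? P? = map′ (λ (X , u , p) → (X , u) , p) (λ ((X , u) , p) → X , u , p)
    (any? λ X → any? λ u → P? (X , u))

  abstract
    -- The argument only refutes the absence of a triangle; a finite search turns this into a
    -- witness.
    triangle : ∃[ c ] ∃[ x ] ∃[ y ] ∃[ z ] Triangle c x y z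
    triangle = decidable-stable
      (any? λ c → any-vertex? λ x → any-vertex? λ y → any-vertex? λ z → triangle? c x y z)
      λ none → TriangleFree.no-triangle⇒⊥ col col-sym λ xy xz yz e e′ e″ → none (_ , _ , _ , _ , xy , xz , yz , e , e′ , e″)

  triangle⇒monochromatic : ∀ {c x y z} → Triangle c x y z → Σ[ K ∈ Clique H 3 ] Monochromatic χ c K
  triangle⇒monochromatic {c} {x} {y} {z} (xy , xz , yz , e , e′ , e″) = record { vertex = vertex ; adjacent = adjacent } , mono
    where
    corner : Fin 3 → V
    corner 0F = x
    corner 1F = y
    corner 2F = z

    vertex : Fin 3 → Vertex H
    vertex i = vertexOf (corner i)

    joined : ∀ i j → i ≢ j → corner i ~ corner j × col (corner i) (corner j) ≡ c
    joined 0F 0F i≢i = contradiction refl i≢i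
    joined 0F 1F _ = xy , e
    joined 0F 2F _ = xz , e′
    joined 1F 0F _ = ~-sym xy , trans (col-sym y x) e
    joined 1F 1F i≢i = contradiction refl i≢i
    joined 1F 2F _ = yz , e″
    joined 2F 0F _ = ~-sym xz , trans (col-sym z x) e′
    joined 2F 1F _ = ~-sym yz , trans (col-sym z y) e″
    joined 2F 2F i≢i = contradiction refl i≢i

    adjacent : ∀ i j → i ≢ j → Adj H (vertex i) (vertex j)
    adjacent i j i≢j = vertexOf-adj (proj₁ (joined i j i≢j))

    mono : ∀ i j i≢j → colour (vertex i) (vertex j) (adjacent i j i≢j) ≡ c
    mono i j i≢j = trans (sym (col-colour {corner i} {corner j} _)) (proj₂ (joined i j i≢j))

mainTheorem1 : C₅ +ᶻ C₅ +ᶻ C₅ +ᶻ C₅ +ᶻ C₅ +ᶻ C₅ →ₑ 3 ∷ 3 ∷ 3 ∷ []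
mainTheorem1 χ = case triangle χ of λ where
  -- Splitting on the colour makes the `lookup` of the clique size compute to 3.
  (0F , _ , _ , _ , t) → 0F , triangle⇒monochromatic χ t
  (1F , _ , _ , _ , t) → 1F , triangle⇒monochromatic χ t
  (2F , _ , _ , _ , t) → 2F , triangle⇒monochromatic χ t
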